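{- For any graph $G=(V,E)$, let $|V|=n$, $|E|=m$ and $$\Delta = 4n(n-1)-\frac{16m}{k-1}+1,$$ where $\Delta=\Theta(n^2)$ for $k\geq 4$, and $\Delta=\Theta\left(\binom{n}{2}-m\right)$ for $k=3$. Then $$a_k(G)\geq \frac{1}{2}\left(2n+1-\sqrt{\Delta}\right)$$ for any $k\geq 3$.
   Context: Graphs are finite, simple and undirected, and $k$ is an integer. Let $\mathcal{C}_k=\{C_i : i\geq k\}$ be the family of all cycles of length at least $k$. A $C_k$-coloring of a graph $G$ is a proper vertex coloring of $G$ in which no subgraph of $G$ that is a member of $\mathcal{C}_k$ is bicolored, i.e. has its vertices colored using only two colors. The $C_k$-chromatic number $a_k(G)$ is the minimum number of colors needed for a $C_k$-coloring of $G$. Here $\Delta$ is just the number defined in the claim, not the maximum degree; $\binom{n}{2}-m$ is the number of nonedges of $G$; and $\Theta$ is the usual asymptotic notation for "is of the order of". -}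

module Defs where

open import Data.Fin.Base using (Fin; toℕ)
import Data.Fin.Properties as Fin
open import Data.Integer.Base using (+_)
open import Data.List.Base using (List; allFin; cartesianProduct; filter; length)
open import Data.Nat.Base as ℕ using (ℕ; suc; z≤n; s≤s)
open import Data.Nat.Combinatorics using (_C_)
import Data.Nat.Properties as ℕ
open import Data.Product.Base using (_×_; _,_; ∃; ∃-syntax)
open import Data.Rational.Base
open import Data.Rational.Properties
open import Data.Rational.Solver using (module +-*-Solver)
open import Data.Sum.Base as Sum using (_⊎_; inj₁; inj₂; swap)
open import Function.Definitions using (Injective)
open import Level using (0ℓ; Level)
open import Relation.Binary.Core using (Rel)
open import Relation.Binary.Definitions using (Decidable; Irreflexive; Symmetric)
open import Relation.Binary.PropositionalEquality
open import Relation.Nullary.Decidable using (yes; no; _×-dec_; _⊎-dec_)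
open import Relation.Nullary.Negation using (¬_; contradiction)

------------------------------------------------------------------------
-- Graphs

record Graph : Set₁ where
  field
    order   : ℕ
    Adj     : Rel (Fin order) 0ℓ
    irrefl  : Irreflexive _≡_ Adj
    sym-Adj : Symmetric Adj
    Adj?    : Decidable Adj

  Vertex : Set
  Vertex = Fin order

  -- Each edge is listed once, with its smaller end first.
  edges : List (Vertex × Vertex)
  edges = filter (λ (u , v) → (u Fin.<? v) ×-dec Adj? u v)
                 (cartesianProduct (allFin order) (allFin order))

  size : ℕ
  size = length edges

open Graph using (order; size; Vertex; Adj)

-- A (not necessarily induced) subgraph of G isomorphic to H.
record Copy (H G : Graph) : Set where
  field
    vertex    : Vertex H → Vertex G
    injective : Injective _≡_ _≡_ vertex
    adjacent  : ∀ {i j} → Adj H i j → Adj G (vertex i) (vertex j)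

-- j follows i in the cyclic order 0, 1, …, n − 1, 0.
Next : ∀ {n} → Rel (Fin n) 0ℓ
Next {n} i j = (toℕ j ≡ suc (toℕ i)) ⊎ (suc (toℕ i) ≡ n × toℕ j ≡ 0)

Next? : ∀ {n} → Decidable (Next {n})
Next? {n} i j = (toℕ j ℕ.≟ suc (toℕ i)) ⊎-dec ((suc (toℕ i) ℕ.≟ n) ×-dec (toℕ j ℕ.≟ 0))

Next-irrefl : ∀ {n} → 3 ℕ.≤ n → (i : Fin n) → ¬ Next i i
Next-irrefl _   i (inj₁ i≡1+i)       = ℕ.1+n≢n (sym i≡1+i)
Next-irrefl 3≤n i (inj₂ (1+i≡n , i≡0)) =
  contradiction (subst (3 ℕ.≤_) (trans (sym 1+i≡n) (cong suc i≡0)) 3≤n) λ { (s≤s ()) }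

cycle : (n : ℕ) → 3 ℕ.≤ n → Graph
cycle n 3≤n = record
  { order   = n
  ; Adj     = λ i j → Next i j ⊎ Next j i
  ; irrefl  = λ { {i} refl → Sum.[ Next-irrefl 3≤n i , Next-irrefl 3≤n i ] }
  ; sym-Adj = swap
  ; Adj?    = λ i j → Next? i j ⊎-dec Next? j i
  }

------------------------------------------------------------------------
-- C_k-colorings

Proper : (G : Graph) {c : ℕ} → (Vertex G → Fin c) → Set
Proper G col = ∀ {u v} → Adj G u v → col u ≢ col v

Bicolored : {H G : Graph} {c : ℕ} → (Vertex G → Fin c) → Copy H G → Set
Bicolored {H} col S = ∃[ a ] ∃[ b ] ∀ (i : Vertex H) → col (vertex i) ≡ a ⊎ col (vertex i) ≡ b
  where open Copy S

IsCycleColoring : (k : ℕ) (G : Graph) {c : ℕ} → (Vertex G → Fin c) → Set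
IsCycleColoring k G col =
  Proper G col ×
  (∀ i (3≤i : 3 ℕ.≤ i) → k ℕ.≤ i → (S : Copy (cycle i 3≤i) G) → ¬ Bicolored col S)

CycleColorable : (k : ℕ) → Graph → ℕ → Set
CycleColorable k G c = ∃ λ (col : Vertex G → Fin c) → IsCycleColoring k G col

-- a is a_k(G), the least number of colors in a C_k-coloring.
IsCycleChromaticNumber : (k : ℕ) → Graph → ℕ → Set
IsCycleChromaticNumber k G a =
  CycleColorable k G a × (∀ c → CycleColorable k G c → a ℕ.≤ c)

------------------------------------------------------------------------
-- Rational quantities

fromℕ : ℕ → ℚ
fromℕ n = + n / 1

Δ : (k : ℕ) → 3 ℕ.≤ k → Graph → ℚ
Δ k 3≤k G = fromℕ 4 * n * (n - 1ℚ) - (+ (16 ℕ.* size G) / (k ℕ.∸ 1)) + 1ℚ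
  where
  n = fromℕ (order G)
  instance
    k-1≢0 : ℕ.NonZero (k ℕ.∸ 1)
    k-1≢0 = ℕ.>-nonZero (ℕ.m<n⇒0<n∸m (ℕ.≤-trans (s≤s (s≤s z≤n)) 3≤k))

order² : Graph → ℚ
order² G = fromℕ (order G) * fromℕ (order G)

nonedges : Graph → ℚ
nonedges G = fromℕ (order G C 2) - fromℕ (size G)

-- g = Θ(f), asymptotically as f → ∞.  The threshold N is on the value of f:
-- for f = n² this is the same as a threshold on n, while for f = nonedges a
-- threshold on n could not work, as complete graphs of every order have
-- nonedges = 0 but Δ = 1 (for k = 3).
_=Θ_ : {ℓ : Level} {I : Set ℓ} → (I → ℚ) → (I → ℚ) → Set ℓ
g =Θ f = ∃[ c₁ ] ∃[ c₂ ] ∃[ N ] 0ℚ < c₁ × 0ℚ < c₂ ×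
  (∀ i → N ≤ f i → c₁ * f i ≤ g i × g i ≤ c₂ * f i)

------------------------------------------------------------------------
-- Dedekind reals

record ℝ : Set₁ where
  field
    L U      : ℚ → Set                       -- L q is q < x, U q is x < q
    L-inhab  : ∃ L
    U-inhab  : ∃ U
    L-closed : ∀ {q r} → q < r → L r → L q
    U-closed : ∀ {q r} → q < r → U q → U r
    L-open   : ∀ {q} → L q → ∃[ r ] q < r × L r
    U-open   : ∀ {r} → U r → ∃[ q ] q < r × U q
    disjoint : ∀ {q} → L q → ¬ U q
    located  : ∀ {q r} → q < r → L q ⊎ U r

infix 4 _≤ᴿ_ _≥ᴿ_

_≤ᴿ_ _≥ᴿ_ : Rel ℝ 0ℓ
x ≤ᴿ y = ∀ q → ℝ.L x q → ℝ.L y q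
x ≥ᴿ y = y ≤ᴿ x

private
  q<q+1 : ∀ q → q < q + 1ℚ
  q<q+1 q = subst (_< q + 1ℚ) (+-identityʳ q) (+-monoʳ-< q (positive⁻¹ 1ℚ))

  q-1<q : ∀ q → q - 1ℚ < q
  q-1<q q = subst (q - 1ℚ <_) (+-identityʳ q) (+-monoʳ-< q (negative⁻¹ (- 1ℚ)))

fromℚ : ℚ → ℝ
fromℚ p = record
  { L        = _< p
  ; U        = p <_
  ; L-inhab  = p - 1ℚ , q-1<q p
  ; U-inhab  = p + 1ℚ , q<q+1 p
  ; L-closed = <-trans
  ; U-closed = λ q<r p<q → <-trans p<q q<r
  ; L-open   = <-dense
  ; U-open   = λ p<r → let q , p<q , q<r = <-dense p<r in q , q<r , p<q
  ; disjoint = <-asym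
  ; located  = located
  }
  where
  located : ∀ {q r} → q < r → q < p ⊎ p < r
  located {q} q<r with q <? p
  ... | yes q<p = inj₁ q<p
  ... | no  q≮p = inj₂ (≤-<-trans (≮⇒≥ q≮p) q<r)

private
  p-[p-q]≡q : ∀ p q → p - (p - q) ≡ q
  p-[p-q]≡q = solve 2 (λ p q → p :- (p :- q) := q) refl
    where open +-*-Solver

  -‿antimono-< : ∀ p {q r} → q < r → p - r < p - q
  -‿antimono-< p q<r = +-monoʳ-< p (neg-antimono-< q<r)

infixl 6 _-ᴿ_

_-ᴿ_ : ℚ → ℝ → ℝ
p -ᴿ x = record
  { L        = λ q → X.U (p - q)
  ; U        = λ q → X.L (p - q)
  ; L-inhab  = let q , u = X.U-inhab in p - q , subst X.U (sym (p-[p-q]≡q p q)) u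
  ; U-inhab  = let q , l = X.L-inhab in p - q , subst X.L (sym (p-[p-q]≡q p q)) l
  ; L-closed = λ q<r → X.U-closed (-‿antimono-< p q<r)
  ; U-closed = λ q<r → X.L-closed (-‿antimono-< p q<r)
  ; L-open   = λ {q} u → let s , s<p-q , u′ = X.U-open u in
      p - s , subst (_< p - s) (p-[p-q]≡q p q) (-‿antimono-< p s<p-q)
            , subst X.U (sym (p-[p-q]≡q p s)) u′
  ; U-open   = λ {q} l → let s , p-q<s , l′ = X.L-open l in
      p - s , subst (p - s <_) (p-[p-q]≡q p q) (-‿antimono-< p p-q<s)
            , subst X.L (sym (p-[p-q]≡q p s)) l′
  ; disjoint = λ u l → X.disjoint l u
  ; located  = λ q<r → swap (X.located (-‿antimono-< p q<r))
  }
  where module X = ℝ x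

infixr 7 _*ᴿ_

_*ᴿ_ : (c : ℚ) .{{_ : Positive c}} → ℝ → ℝ
c *ᴿ x = record
  { L        = λ q → X.L (c⁻¹ * q)
  ; U        = λ q → X.U (c⁻¹ * q)
  ; L-inhab  = let q , l = X.L-inhab in c * q , subst X.L (sym (c⁻¹*[c*q]≡q q)) l
  ; U-inhab  = let q , u = X.U-inhab in c * q , subst X.U (sym (c⁻¹*[c*q]≡q q)) u
  ; L-closed = λ q<r → X.L-closed (*-monoʳ-<-pos c⁻¹ q<r)
  ; U-closed = λ q<r → X.U-closed (*-monoʳ-<-pos c⁻¹ q<r)
  ; L-open   = λ {q} l → let s , q/c<s , l′ = X.L-open l in
      c * s , subst (_< c * s) (c*[c⁻¹*q]≡q q) (*-monoʳ-<-pos c q/c<s)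
            , subst X.L (sym (c⁻¹*[c*q]≡q s)) l′
  ; U-open   = λ {q} u → let s , s<q/c , u′ = X.U-open u in
      c * s , subst (c * s <_) (c*[c⁻¹*q]≡q q) (*-monoʳ-<-pos c s<q/c)
            , subst X.U (sym (c⁻¹*[c*q]≡q s)) u′
  ; disjoint = X.disjoint
  ; located  = λ q<r → X.located (*-monoʳ-<-pos c⁻¹ q<r)
  }
  where
  module X = ℝ x
  instance
    c≢0 : NonZero c
    c≢0 = pos⇒nonZero c
  c⁻¹ : ℚ
  c⁻¹ = 1/ c
  instance
    c⁻¹>0 : Positive c⁻¹
    c⁻¹>0 = 1/pos⇒pos c
  c⁻¹*[c*q]≡q : ∀ q → c⁻¹ * (c * q) ≡ q
  c⁻¹*[c*q]≡q q = trans (sym (*-assoc c⁻¹ c q))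
    (trans (cong (_* q) (*-inverseˡ c)) (*-identityˡ q))
  c*[c⁻¹*q]≡q : ∀ q → c * (c⁻¹ * q) ≡ q
  c*[c⁻¹*q]≡q q = trans (sym (*-assoc c c⁻¹ q))
    (trans (cong (_* q) (*-inverseʳ c)) (*-identityˡ q))

private
  square-mono-< : ∀ {q r} → 0ℚ ≤ q → q < r → q * q < r * r
  square-mono-< {q} {r} 0≤q q<r =
    ≤-<-trans (*-monoˡ-≤-nonNeg q {{nonNegative 0≤q}} (<⇒≤ q<r))
              (*-monoˡ-<-pos r {{positive (≤-<-trans 0≤q q<r)}} q<r)

-- Stating the cuts through an intermediate r makes openness immediate; the
-- lower cut is { q | q < 0 or q² < d } when d ≥ 0.  For d < 0 this is 0.
√_ : ℚ → ℝ
√ d = record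
  { L        = λ q → ∃[ r ] q < r × (r ≤ 0ℚ ⊎ r * r ≤ d)
  ; U        = λ q → ∃[ r ] r < q × (0ℚ ≤ r × d ≤ r * r)
  ; L-inhab  = 0ℚ - 1ℚ , 0ℚ , q-1<q 0ℚ , inj₁ ≤-refl
  ; U-inhab  = U-inhab
  ; L-closed = λ { q<r (s , r<s , h) → s , <-trans q<r r<s , h }
  ; U-closed = λ { q<r (s , s<q , h) → s , <-trans s<q q<r , h }
  ; L-open   = λ { (s , q<s , h) → let r , q<r , r<s = <-dense q<s in r , q<r , s , r<s , h }
  ; U-open   = λ { (s , s<r , h) → let q , s<q , q<r = <-dense s<r in q , q<r , s , s<q , h }
  ; disjoint = disjoint
  ; located  = located
  }
  where
  U-inhab : ∃[ q ] ∃[ r ] r < q × (0ℚ ≤ r × d ≤ r * r)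
  U-inhab with ≤-total d 1ℚ
  ... | inj₁ d≤1 = 1ℚ + 1ℚ , 1ℚ , q<q+1 1ℚ , <⇒≤ (positive⁻¹ 1ℚ) , d≤1
  ... | inj₂ 1≤d = d + 1ℚ , d , q<q+1 d , 0≤d ,
        subst (_≤ d * d) (*-identityʳ d) (*-monoˡ-≤-nonNeg d {{nonNegative 0≤d}} 1≤d)
    where
    0≤d : 0ℚ ≤ d
    0≤d = ≤-trans (<⇒≤ (positive⁻¹ 1ℚ)) 1≤d

  disjoint : ∀ {q} → ∃[ r ] q < r × (r ≤ 0ℚ ⊎ r * r ≤ d) →
             ¬ (∃[ r ] r < q × (0ℚ ≤ r × d ≤ r * r))
  disjoint (r , q<r , inj₁ r≤0) (s , s<q , 0≤s , _) =
    <-irrefl refl (<-≤-trans (<-trans s<q q<r) (≤-trans r≤0 0≤s))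
  disjoint (r , q<r , inj₂ r²≤d) (s , s<q , 0≤s , d≤s²) =
    <-irrefl refl
      (<-≤-trans (square-mono-< 0≤s (<-trans s<q q<r)) (≤-trans r²≤d d≤s²))

  located : ∀ {q r} → q < r → (∃[ s ] q < s × (s ≤ 0ℚ ⊎ s * s ≤ d)) ⊎
                              (∃[ s ] s < r × (0ℚ ≤ s × d ≤ s * s))
  located q<r with <-dense q<r
  ... | s , q<s , s<r with ≤-total s 0ℚ | ≤-total (s * s) d
  ...   | inj₁ s≤0 | _         = inj₁ (s , q<s , inj₁ s≤0)
  ...   | inj₂ 0≤s | inj₁ s²≤d = inj₁ (s , q<s , inj₂ s²≤d)
  ...   | inj₂ 0≤s | inj₂ d≤s² = inj₂ (s , s<r , 0≤s , d≤s²)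

{-# OPTIONS --safe #-}
-- The vertices of two colour classes induce a bipartite graph without cycles of length ≥ k.  In such
-- a graph, a path v, … that cannot be extended beyond v contains all neighbours of v, each at an odd
-- distance along the path, so the last of them closes a cycle of length at least 2 deg v.  Hence some
-- vertex satisfies 2 deg v ≤ k − 1, and removing such vertices one by one shows that N ≥ 1 vertices
-- carry at most (k − 1)(N − 1) / 2 edges.  In a colouring with the least number c of colours every
-- class is nonempty, so summing over all pairs of classes gives
-- 2m / (k − 1) ≤ (c − 1) n − c (c − 1) / 2, a quadratic inequality in c with discriminant Δ.
module Submission where

open import Defs
open import Data.Nat.Base using (ℕ; _≤_; _+_; _*_)
open import Data.Nat.Properties using (≤-refl; ≤-trans; n≤1+n)
open import Data.Product.Base using (_×_; _,_; ∃-syntax)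
open import Data.Rational.Base using (½)

open import Data.Bool.Base using (if_then_else_)
open import Data.Fin.Base using (Fin; zero; suc; toℕ; inject≤; punchIn; punchOut)
import Data.Fin.Properties as Fin
import Data.Integer.Base as ℤ
import Data.Integer.Properties as ℤ
open import Data.List.Base using (List; []; _∷_; [_]; _++_; allFin; cartesianProduct; filter; length; lookup; map; take)
import Data.List.Membership.DecPropositional as DecMembership
open import Data.List.Membership.Propositional using (_∈_; _∉_; find; lose)
open import Data.List.Membership.Propositional.Properties
open import Data.List.Properties using (length-++; length-tabulate; length-take; map-++; map-∘)
open import Data.List.Relation.Binary.Permutation.Propositional using (_↭_; ↭⇒↭ₛ)
open import Data.List.Relation.Binary.Permutation.Propositional.Properties using (map⁺; shift; All-resp-↭; ↭-length)
import Data.List.Relation.Binary.Permutation.Setoid.Properties as Permutationₛ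
open import Data.List.Relation.Unary.All as All using (All; []; _∷_)
import Data.List.Relation.Unary.All.Properties as All
open import Data.List.Relation.Unary.All.Properties using (All¬⇒¬Any; ¬Any⇒All¬; all-filter)
open import Data.List.Relation.Unary.AllPairs using ([]; _∷_)
open import Data.List.Relation.Unary.Any using (here; there; any?)
open import Data.List.Relation.Unary.Linked using (Linked; []; [-]; _∷_)
open import Data.List.Relation.Unary.Unique.Propositional using (Unique)
open import Data.List.Relation.Unary.Unique.Propositional.Properties using (allFin⁺; filter⁺; ++⁺)
open import Data.Nat.Base using (zero; suc; _∸_; _<_; z≤n; s≤s; NonZero)
open import Data.Nat.Combinatorics using (_C_; nC1≡n; nCk+nC[k+1]≡[n+1]C[k+1])
import Data.Nat.ListAction as ℕ using (sum)
open import Data.Nat.ListAction.Properties using (sum-++; sum-↭)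
open import Data.Nat.Properties
import Data.Nat.Solver as ℕ
open import Data.Product.Base using (proj₁; proj₂)
open import Data.Rational.Base as ℚ using (ℚ; 0ℚ; 1ℚ; toℚᵘ)
import Data.Rational.Properties as ℚ
import Data.Rational.Solver as ℚ
open import Data.Rational.Unnormalised.Base as ℚᵘ using (mkℚᵘ; *≡*; *≤*)
import Data.Rational.Unnormalised.Properties as ℚᵘ
open import Data.Sum.Base as Sum using (_⊎_; inj₁; inj₂)
open import Function.Base using (_∘_; const)
open import Level using (0ℓ)
open import Relation.Binary.Core using (Rel)
open import Relation.Binary.Definitions using (tri<; tri≈; tri>)
open import Relation.Binary.PropositionalEquality
  using (_≡_; _≢_; refl; sym; trans; cong; cong₂; subst; subst₂; setoid; module ≡-Reasoning)
open import Relation.Nullary.Decidable using (Dec; yes; no; does; ¬?; _×-dec_; dec-true; dec-false)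
open import Relation.Nullary.Negation using (¬_; contradiction)
open import Relation.Unary using (Decidable)

private
  variable
    A B : Set

-- Finite sums

-- Cardinalities are written as sums of such indicators, so that double counting becomes an exchange
-- of two sums.
𝟙 : {P : Set} → Dec P → ℕ
𝟙 P? = if does P? then 1 else 0

𝟙-yes : {P : Set} (P? : Dec P) → P → 𝟙 P? ≡ 1
𝟙-yes P? p = cong (if_then 1 else 0) (dec-true P? p)

𝟙-no : {P : Set} (P? : Dec P) → ¬ P → 𝟙 P? ≡ 0
𝟙-no P? ¬p = cong (if_then 1 else 0) (dec-false P? ¬p)

𝟙≤1 : {P : Set} (P? : Dec P) → 𝟙 P? ≤ 1
𝟙≤1 (yes _) = ≤-refl
𝟙≤1 (no _)  = z≤n

𝟙>0⇒ : {P : Set} (P? : Dec P) → 0 < 𝟙 P? → P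
𝟙>0⇒ (yes p) _ = p

𝟙-× : {P Q : Set} (P? : Dec P) (Q? : Dec Q) → 𝟙 (P? ×-dec Q?) ≡ 𝟙 P? * 𝟙 Q?
𝟙-× (yes _) Q? = sym (*-identityˡ (𝟙 Q?))
𝟙-× (no _)  Q? = refl

∑ : List A → (A → ℕ) → ℕ
∑ xs f = ℕ.sum (map f xs)

infix 6.5 ∑
syntax ∑ xs (λ x → e) = ∑[ x ∈ xs ] e

∑-cong : ∀ (xs : List A) {f g : A → ℕ} → (∀ x → f x ≡ g x) → ∑ xs f ≡ ∑ xs g
∑-cong []       f≡g = refl
∑-cong (x ∷ xs) f≡g = cong₂ _+_ (f≡g x) (∑-cong xs f≡g)

∑-mono : ∀ (xs : List A) {f g : A → ℕ} → (∀ x → f x ≤ g x) → ∑ xs f ≤ ∑ xs g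
∑-mono []       f≤g = z≤n
∑-mono (x ∷ xs) f≤g = +-mono-≤ (f≤g x) (∑-mono xs f≤g)

+-interchange : ∀ a b c d → (a + b) + (c + d) ≡ (a + c) + (b + d)
+-interchange = solve 4 (λ a b c d → (a :+ b) :+ (c :+ d) := (a :+ c) :+ (b :+ d)) refl
  where open ℕ.+-*-Solver

∑-+ : ∀ (xs : List A) (f g : A → ℕ) → ∑[ x ∈ xs ] (f x + g x) ≡ ∑ xs f + ∑ xs g
∑-+ []       f g = refl
∑-+ (x ∷ xs) f g =
  trans (cong (f x + g x +_) (∑-+ xs f g)) (+-interchange (f x) (g x) (∑ xs f) (∑ xs g))

∑-* : ∀ c (xs : List A) (f : A → ℕ) → ∑[ x ∈ xs ] (c * f x) ≡ c * ∑ xs f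
∑-* c []       f = sym (*-zeroʳ c)
∑-* c (x ∷ xs) f = trans (cong (c * f x +_) (∑-* c xs f)) (sym (*-distribˡ-+ c (f x) (∑ xs f)))

∑-const : ∀ (xs : List A) c → ∑ xs (const c) ≡ length xs * c
∑-const []       c = refl
∑-const (x ∷ xs) c = cong (c +_) (∑-const xs c)

∑-++ : ∀ (xs ys : List A) f → ∑ (xs ++ ys) f ≡ ∑ xs f + ∑ ys f
∑-++ xs ys f = trans (cong ℕ.sum (map-++ f xs ys)) (sum-++ (map f xs) (map f ys))

∑-↭ : ∀ {xs ys : List A} f → xs ↭ ys → ∑ xs f ≡ ∑ ys f
∑-↭ f xs↭ys = sum-↭ (map⁺ f xs↭ys)

∑-swap : ∀ (xs : List A) (ys : List B) (f : A → B → ℕ) →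
         ∑[ x ∈ xs ] ∑[ y ∈ ys ] f x y ≡ ∑[ y ∈ ys ] ∑[ x ∈ xs ] f x y
∑-swap []       ys f = sym (trans (∑-const ys 0) (*-zeroʳ (length ys)))
∑-swap (x ∷ xs) ys f = trans (cong (∑ ys (f x) +_) (∑-swap xs ys f))
                             (sym (∑-+ ys (f x) λ y → ∑[ x ∈ xs ] f x y))

∑-filter : ∀ {P : A → Set} (P? : Decidable P) xs f →
           ∑ (filter P? xs) f ≡ ∑[ x ∈ xs ] (𝟙 (P? x) * f x)
∑-filter P? []       f = refl
∑-filter P? (x ∷ xs) f with P? x
... | yes _ = cong₂ _+_ (sym (+-identityʳ (f x))) (∑-filter P? xs f)
... | no  _ = ∑-filter P? xs f

∑-cartesianProduct : ∀ (xs : List A) (ys : List B) f →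
                     ∑ (cartesianProduct xs ys) f ≡ ∑[ x ∈ xs ] ∑[ y ∈ ys ] f (x , y)
∑-cartesianProduct []       ys f = refl
∑-cartesianProduct (x ∷ xs) ys f =
  trans (∑-++ (map (x ,_) ys) (cartesianProduct xs ys) f)
        (cong₂ _+_ (cong ℕ.sum (sym (map-∘ ys))) (∑-cartesianProduct xs ys f))

length≡∑1 : ∀ (xs : List A) → length xs ≡ ∑ xs (const 1)
length≡∑1 xs = sym (trans (∑-const xs 1) (*-identityʳ (length xs)))

-- Each entry of positive weight is matched with an occurrence in `ys`, which is then removed;
-- entries of weight 0 may be missing from `ys`. With weight `adj v`, only the neighbours of `v`
-- have to be found in `ys`.
∑-≤-⊆ : ∀ {xs ys : List A} (f : A → ℕ) → Unique xs →
        (∀ {x} → x ∈ xs → 0 < f x → x ∈ ys) → ∑ xs f ≤ ∑ ys f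
∑-≤-⊆ {xs = []}     f _            _     = z≤n
∑-≤-⊆ {xs = x ∷ xs} {ys} f (x∉xs ∷ xs!) xs⊆ys with f x in fx≡
... | zero  = ∑-≤-⊆ f xs! (xs⊆ys ∘ there)
... | suc m with as , bs , refl ← ∈-∃++ (xs⊆ys (here refl) (subst (0 <_) (sym fx≡) (s≤s z≤n))) = begin
  suc m + ∑ xs f         ≤⟨ +-monoʳ-≤ (suc m) (∑-≤-⊆ {ys = as ++ bs} f xs! xs⊆) ⟩
  suc m + ∑ (as ++ bs) f ≡⟨ cong (_+ ∑ (as ++ bs) f) fx≡ ⟨
  ∑ (x ∷ as ++ bs) f     ≡⟨ ∑-↭ f (shift x as bs) ⟨
  ∑ (as ++ x ∷ bs) f     ∎
  where
  open ≤-Reasoning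
  xs⊆ : ∀ {y} → y ∈ xs → 0 < f y → y ∈ as ++ bs
  xs⊆ y∈xs 0<fy with ∈-++⁻ as (xs⊆ys (there y∈xs) 0<fy)
  ... | inj₁ y∈as         = ∈-++⁺ˡ y∈as
  -- A later entry of `xs` cannot be the occurrence of `x` that was removed, because `xs` has no
  -- repetitions.
  ... | inj₂ (here refl)  = contradiction y∈xs (All¬⇒¬Any x∉xs)
  ... | inj₂ (there y∈bs) = ∈-++⁺ʳ as y∈bs

length-≤-⊆ : ∀ {xs ys : List A} → Unique xs → (∀ {x} → x ∈ xs → x ∈ ys) → length xs ≤ length ys
length-≤-⊆ {xs = xs} {ys} xs! xs⊆ys = subst₂ _≤_ (sym (length≡∑1 xs)) (sym (length≡∑1 ys))
  (∑-≤-⊆ (const 1) xs! λ x∈xs _ → xs⊆ys x∈xs)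

∑-Fin-δ : ∀ {n} (i : Fin n) (f : Fin n → ℕ) → ∑[ j ∈ allFin n ] (𝟙 (i Fin.≟ j) * f j) ≡ f i
∑-Fin-δ {n} i f = ∑-δ (allFin⁺ n) (∈-allFin i)
  where
  ∑-δ∉ : ∀ {xs} → i ∉ xs → ∑[ j ∈ xs ] (𝟙 (i Fin.≟ j) * f j) ≡ 0
  ∑-δ∉ {[]}     _    = refl
  ∑-δ∉ {x ∷ xs} i∉xs = cong₂ _+_ (cong (_* f x) (𝟙-no (i Fin.≟ x) (i∉xs ∘ here))) (∑-δ∉ (i∉xs ∘ there))
  ∑-δ : ∀ {xs} → Unique xs → i ∈ xs → ∑[ j ∈ xs ] (𝟙 (i Fin.≟ j) * f j) ≡ f i
  ∑-δ (i∉xs ∷ _) (here refl) = trans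
    (cong₂ _+_ (cong (_* f i) (𝟙-yes (i Fin.≟ i) refl)) (∑-δ∉ (All¬⇒¬Any i∉xs)))
    (trans (+-identityʳ _) (*-identityˡ (f i)))
  ∑-δ {x ∷ xs} (x∉xs ∷ xs!) (there i∈xs) = trans
    (cong (λ m → m * f x + ∑[ j ∈ xs ] (𝟙 (i Fin.≟ j) * f j))
      (𝟙-no (i Fin.≟ x) (λ { refl → All¬⇒¬Any x∉xs i∈xs })))
    (∑-δ xs! i∈xs)

-- After the exchange of sums, each `x` is counted for exactly one `a`, namely `g x`.
∑-fibres : ∀ {c} (g : A → Fin c) xs f →
           ∑[ a ∈ allFin c ] ∑[ x ∈ filter (λ x → g x Fin.≟ a) xs ] f x ≡ ∑ xs f
∑-fibres {c = c} g xs f = begin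
  ∑[ a ∈ allFin c ] ∑[ x ∈ filter (λ x → g x Fin.≟ a) xs ] f x
    ≡⟨ ∑-cong (allFin c) (λ a → ∑-filter (λ x → g x Fin.≟ a) xs f) ⟩
  ∑[ a ∈ allFin c ] ∑[ x ∈ xs ] (𝟙 (g x Fin.≟ a) * f x)
    ≡⟨ ∑-swap (allFin c) xs _ ⟩
  ∑[ x ∈ xs ] ∑[ a ∈ allFin c ] (𝟙 (g x Fin.≟ a) * f x)
    ≡⟨ ∑-cong xs (λ x → ∑-Fin-δ (g x) (const (f x))) ⟩
  ∑ xs f ∎
  where open ≡-Reasoning

-- Paths and two-coloured subgraphs

Unique-resp-↭ : ∀ {xs ys : List A} → xs ↭ ys → Unique xs → Unique ys
Unique-resp-↭ xs↭ys = Permutationₛ.Unique-resp-↭ (setoid _) (↭⇒↭ₛ xs↭ys)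

lookup-injective : ∀ {xs : List A} → Unique xs → ∀ i j → lookup xs i ≡ lookup xs j → i ≡ j
lookup-injective (_ ∷ _)    zero    zero    _  = refl
lookup-injective (x∉xs ∷ _) zero    (suc j) eq = contradiction eq (All.lookup x∉xs (∈-lookup j))
lookup-injective (x∉xs ∷ _) (suc i) zero    eq = contradiction (sym eq) (All.lookup x∉xs (∈-lookup i))
lookup-injective (_ ∷ xs!)  (suc i) (suc j) eq = cong suc (lookup-injective xs! i j eq)

Linked-lookup : ∀ {R : Rel A 0ℓ} {xs} → Linked R xs → ∀ i j → toℕ j ≡ suc (toℕ i) →
                R (lookup xs i) (lookup xs j)
Linked-lookup (x∼y ∷ _)  zero    (suc zero) _  = x∼y
Linked-lookup (_ ∷ y∷xs) (suc i) (suc j)    eq = Linked-lookup y∷xs i j (suc-injective eq)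

Linked-take : ∀ {R : Rel A 0ℓ} n {xs} → Linked R xs → Linked R (take n xs)
Linked-take zero          _           = []
Linked-take (suc n)       []          = []
Linked-take (suc zero)    [-]         = [-]
Linked-take (suc (suc n)) [-]         = [-]
Linked-take (suc zero)    (_ ∷ _)     = [-]
Linked-take (suc (suc n)) (x∼y ∷ xs∼) = x∼y ∷ Linked-take (suc n) xs∼

-- Meant for a neighbour of the head of a path: either it lies in a short initial segment, or its
-- position is late enough to close a long cycle.
∈-take-or-later : ∀ n {x} {xs : List A} → x ∈ xs →
                  x ∈ take n xs ⊎ (∃[ i ] n ≤ toℕ i × lookup xs i ≡ x)
∈-take-or-later (suc n) (here x≡y)   = inj₁ (here x≡y)
∈-take-or-later (suc n) (there x∈xs) = Sum.map there (λ (i , n≤i , eq) → suc i , s≤s n≤i , eq)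
                                               (∈-take-or-later n x∈xs)
∈-take-or-later zero    (here x≡y)   = inj₂ (zero , z≤n , sym x≡y)
∈-take-or-later zero    (there x∈xs) with ∈-take-or-later zero x∈xs
... | inj₂ (i , _ , eq) = inj₂ (suc i , z≤n , eq)

-- Both `x` and `z` avoid the value of `y`, and only one other value is left. Applied to three
-- consecutive vertices of a two-coloured path, it shows that the colours alternate.
third-colour : ∀ {a b x y z : A} → x ≡ a ⊎ x ≡ b → y ≡ a ⊎ y ≡ b → z ≡ a ⊎ z ≡ b →
               x ≢ y → y ≢ z → x ≡ z
third-colour (inj₁ refl) _           (inj₁ refl) _   _   = refl
third-colour (inj₂ refl) _           (inj₂ refl) _   _   = refl
third-colour (inj₁ refl) (inj₁ refl) (inj₂ refl) x≢y _   = contradiction refl x≢y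
third-colour (inj₁ refl) (inj₂ refl) (inj₂ refl) _   y≢z = contradiction refl y≢z
third-colour (inj₂ refl) (inj₁ refl) (inj₁ refl) _   y≢z = contradiction refl y≢z
third-colour (inj₂ refl) (inj₂ refl) (inj₁ refl) x≢y _   = contradiction refl x≢y

-- Degrees and edge counts.

module _ (G : Graph) where
  open Graph G
  open DecMembership (Fin._≟_ {order}) using (_∈?_)

  adj : Vertex → Vertex → ℕ
  adj u v = 𝟙 (Adj? u v)

  adj-sym : ∀ u v → adj u v ≡ adj v u
  adj-sym u v with Adj? u v
  ... | yes uv = sym (𝟙-yes (Adj? v u) (sym-Adj uv))
  ... | no ¬uv = sym (𝟙-no (Adj? v u) (¬uv ∘ sym-Adj))

  degreeIn : List Vertex → Vertex → ℕ
  degreeIn xs v = ∑ xs (adj v)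

  -- For a list `xs` without repetitions, `adjacencies xs xs` is twice the number of edges inside
  -- `xs`, each edge being seen from both ends.
  adjacencies : List Vertex → List Vertex → ℕ
  adjacencies xs ys = ∑[ u ∈ xs ] degreeIn ys u

  adjacencies-++ : ∀ xs ys zs → adjacencies (xs ++ ys) zs ≡ adjacencies xs zs + adjacencies ys zs
  adjacencies-++ xs ys zs = ∑-++ xs ys (degreeIn zs)

  adjacencies-comm : ∀ xs ys → adjacencies xs ys ≡ adjacencies ys xs
  adjacencies-comm xs ys = trans (∑-swap xs ys adj)
    (∑-cong ys λ v → ∑-cong xs λ u → adj-sym u v)

  adjacencies-++ʳ : ∀ xs ys zs → adjacencies zs (xs ++ ys) ≡ adjacencies zs xs + adjacencies zs ys
  adjacencies-++ʳ xs ys zs =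
    trans (∑-cong zs λ u → ∑-++ xs ys (adj u)) (∑-+ zs (degreeIn xs) (degreeIn ys))

  adjacencies-↭ : ∀ {xs ys} → xs ↭ ys → adjacencies xs xs ≡ adjacencies ys ys
  adjacencies-↭ {xs} {ys} xs↭ys =
    trans (∑-cong xs λ u → ∑-↭ (adj u) xs↭ys) (∑-↭ (degreeIn ys) xs↭ys)

  -- The row and the column of `v` contribute its degree once each. The degree is taken in `v ∷ xs`,
  -- the list in which `low-degree` bounds it.
  adjacencies-∷ : ∀ v xs → adjacencies (v ∷ xs) (v ∷ xs) ≤
                           2 * degreeIn (v ∷ xs) v + adjacencies xs xs
  adjacencies-∷ v xs = begin
    degreeIn (v ∷ xs) v + adjacencies xs (v ∷ xs)
      ≡⟨ cong (degreeIn (v ∷ xs) v +_) (adjacencies-++ʳ [ v ] xs xs) ⟩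
    degreeIn (v ∷ xs) v + (adjacencies xs [ v ] + adjacencies xs xs)
      ≡⟨ cong (λ d → degreeIn (v ∷ xs) v + (d + adjacencies xs xs)) (adjacencies-comm xs [ v ]) ⟩
    degreeIn (v ∷ xs) v + ((degreeIn xs v + 0) + adjacencies xs xs)
      ≤⟨ +-monoʳ-≤ (degreeIn (v ∷ xs) v) (+-monoˡ-≤ (adjacencies xs xs)
           (+-monoˡ-≤ 0 (m≤n+m (degreeIn xs v) (adj v v)))) ⟩
    degreeIn (v ∷ xs) v + ((degreeIn (v ∷ xs) v + 0) + adjacencies xs xs)
      ≡⟨ +-assoc (degreeIn (v ∷ xs) v) _ _ ⟨
    2 * degreeIn (v ∷ xs) v + adjacencies xs xs ∎
    where open ≤-Reasoning

  -- The handshake lemma. `edges` lists the pairs with the smaller end first; every ordered adjacent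
  -- pair is one of these or the reverse of one, and an exchange of sums identifies the two counts.
  ∑adj≡2*size : adjacencies (allFin order) (allFin order) ≡ 2 * size
  ∑adj≡2*size = begin
    ∑[ u ∈ V ] ∑[ v ∈ V ] adj u v
      ≡⟨ ∑-cong V (λ u → trans (∑-cong V (λ v → split u v)) (∑-+ V (up u) λ v → up v u)) ⟩
    ∑[ u ∈ V ] (∑[ v ∈ V ] up u v + ∑[ v ∈ V ] up v u)
      ≡⟨ ∑-+ V (λ u → ∑[ v ∈ V ] up u v) (λ u → ∑[ v ∈ V ] up v u) ⟩
    ∑[ u ∈ V ] ∑[ v ∈ V ] up u v + ∑[ u ∈ V ] ∑[ v ∈ V ] up v u
      ≡⟨ cong (∑[ u ∈ V ] ∑[ v ∈ V ] up u v +_) (∑-swap V V (λ u v → up v u)) ⟩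
    ∑[ u ∈ V ] ∑[ v ∈ V ] up u v + ∑[ u ∈ V ] ∑[ v ∈ V ] up u v
      ≡⟨ cong₂ _+_ size≡ size≡ ⟨
    size + size
      ≡⟨ cong (size +_) (+-identityʳ size) ⟨
    2 * size ∎
    where
    open ≡-Reasoning
    V = allFin order
    up? : ∀ u v → Dec (toℕ u < toℕ v × Adj u v)
    up? u v = (u Fin.<? v) ×-dec Adj? u v
    up : Vertex → Vertex → ℕ
    up u v = 𝟙 (up? u v)
    up≡adj : ∀ {u v} → toℕ u < toℕ v → up u v ≡ adj u v
    up≡adj {u} {v} u<v = trans (𝟙-× (u Fin.<? v) (Adj? u v))
      (trans (cong (_* adj u v) (𝟙-yes (u Fin.<? v) u<v)) (*-identityˡ (adj u v)))
    split : ∀ u v → adj u v ≡ up u v + up v u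
    split u v with Fin.<-cmp u v
    ... | tri≈ u≮u refl _ = trans (𝟙-no (Adj? u u) (irrefl refl))
      (sym (cong₂ _+_ (𝟙-no (up? u u) (u≮u ∘ proj₁)) (𝟙-no (up? u u) (u≮u ∘ proj₁))))
    ... | tri< u<v _ v≮u = sym (trans
      (cong₂ _+_ (up≡adj u<v) (𝟙-no (up? v u) (v≮u ∘ proj₁))) (+-identityʳ (adj u v)))
    ... | tri> u≮v _ v<u = sym (trans
      (cong₂ _+_ (𝟙-no (up? u v) (u≮v ∘ proj₁)) (up≡adj v<u)) (adj-sym v u))
    size≡ : size ≡ ∑[ u ∈ V ] ∑[ v ∈ V ] up u v
    size≡ = begin
      size                                          ≡⟨ length≡∑1 edges ⟩
      ∑ edges (const 1)                             ≡⟨ ∑-filter (λ (u , v) → up? u v) (cartesianProduct V V) (const 1) ⟩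
      ∑[ e ∈ cartesianProduct V V ] (𝟙 (up? (proj₁ e) (proj₂ e)) * 1)
        ≡⟨ ∑-cong (cartesianProduct V V) (λ (u , v) → *-identityʳ (up u v)) ⟩
      ∑[ e ∈ cartesianProduct V V ] up (proj₁ e) (proj₂ e)
        ≡⟨ ∑-cartesianProduct V V (λ (u , v) → up u v) ⟩
      ∑[ u ∈ V ] ∑[ v ∈ V ] up u v                  ∎

  length-V : length (allFin order) ≡ order
  length-V = length-tabulate (λ (v : Vertex) → v)

  -- The adjacency matrix has zero diagonal, so adding the identity matrix keeps every entry at most
  -- 1; the entries are then summed.
  2*size+order≤order² : 2 * size + order ≤ order * order
  2*size+order≤order² = begin
    2 * size + order
      ≡⟨ cong₂ _+_ (sym ∑adj≡2*size) (trans (sym length-V) (trans (length≡∑1 V)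
           (∑-cong V λ u → sym (∑-Fin-δ u (const 1))))) ⟩
    adjacencies V V + ∑[ u ∈ V ] ∑[ v ∈ V ] (𝟙 (u Fin.≟ v) * 1)
      ≡⟨ ∑-+ V (degreeIn V) (λ u → ∑[ v ∈ V ] (𝟙 (u Fin.≟ v) * 1)) ⟨
    ∑[ u ∈ V ] (degreeIn V u + ∑[ v ∈ V ] (𝟙 (u Fin.≟ v) * 1))
      ≡⟨ ∑-cong V (λ u → ∑-+ V (adj u) (λ v → 𝟙 (u Fin.≟ v) * 1)) ⟨
    ∑[ u ∈ V ] ∑[ v ∈ V ] (adj u v + 𝟙 (u Fin.≟ v) * 1)
      ≤⟨ ∑-mono V (λ u → ∑-mono V (λ v → ≤1 u v)) ⟩
    ∑[ u ∈ V ] ∑[ v ∈ V ] 1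
      ≡⟨ ∑-cong V (λ u → length≡∑1 V) ⟨
    ∑[ u ∈ V ] length V
      ≡⟨ ∑-const V (length V) ⟩
    length V * length V
      ≡⟨ cong₂ _*_ length-V length-V ⟩
    order * order ∎
    where
    open ≤-Reasoning
    V = allFin order
    ≤1 : ∀ u v → adj u v + 𝟙 (u Fin.≟ v) * 1 ≤ 1
    ≤1 u v with u Fin.≟ v
    ... | no _     = ≤-trans (≤-reflexive (+-identityʳ (adj u v))) (𝟙≤1 (Adj? u v))
    ... | yes refl = ≤-reflexive (cong (_+ 1) (𝟙-no (Adj? u u) (irrefl refl)))

  -- Paths, cycles and edges within two colour classes.

  module _ {c} (col : Vertex → Fin c) (proper : Proper G col) where

    adj-≡col : ∀ {u v} → col u ≡ col v → adj u v ≡ 0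
    adj-≡col {u} {v} eq = 𝟙-no (Adj? u v) λ uv → proper uv eq

    -- Every second vertex of the path has the colour of v, so it is not adjacent to v.
    2*degreeIn-path≤length : ∀ {a b v x xs} → Linked Adj (x ∷ xs) →
      All (λ u → col u ≡ a ⊎ col u ≡ b) (x ∷ xs) → col v ≡ col x →
      2 * degreeIn (x ∷ xs) v ≤ length (x ∷ xs)
    2*degreeIn-path≤length {v = v} {x} {[]} _ _ v≡x
      rewrite adj-≡col {v} {x} v≡x = z≤n
    2*degreeIn-path≤length {v = v} {x} {y ∷ []} _ _ v≡x
      rewrite adj-≡col {v} {x} v≡x | +-identityʳ (adj v y) = *-monoʳ-≤ 2 (𝟙≤1 (Adj? v y))
    2*degreeIn-path≤length {v = v} {x} {y ∷ z ∷ xs} (xy ∷ yz ∷ z∷xs) (px ∷ py ∷ pz ∷ pxs) v≡x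
      rewrite adj-≡col {v} {x} v≡x = begin
      2 * (adj v y + degreeIn (z ∷ xs) v)     ≡⟨ *-distribˡ-+ 2 (adj v y) (degreeIn (z ∷ xs) v) ⟩
      2 * adj v y + 2 * degreeIn (z ∷ xs) v   ≤⟨ +-mono-≤ (*-monoʳ-≤ 2 (𝟙≤1 (Adj? v y)))
        (2*degreeIn-path≤length z∷xs (pz ∷ pxs)
          (trans v≡x (third-colour px py pz (proper xy) (proper yz)))) ⟩
      2 + length (z ∷ xs)                     ∎
      where open ≤-Reasoning

  module _ {c} (col : Vertex → Fin c) {k} (3≤k : 3 ≤ k) (cc : IsCycleColoring k G col) (a b : Fin c) where

    private
      proper = proj₁ cc
      Bi : Vertex → Set
      Bi v = col v ≡ a ⊎ col v ≡ b

    -- Such an edge would close the initial segment of the path up to index `i` into a cycle of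
    -- length i + 1 ≥ k, coloured with `a` and `b` only.
    no-closing-edge : ∀ {v p} → Unique (v ∷ p) → Linked Adj (v ∷ p) → All Bi (v ∷ p) →
      (i : Fin (length (v ∷ p))) → k ≤ suc (toℕ i) → ¬ Adj v (lookup (v ∷ p) i)
    no-closing-edge {v} {p} p! p∼ pBi i k≤ vz =
      proj₂ cc (suc (toℕ i)) (≤-trans 3≤k k≤) k≤ copy (a , b , λ j → All.lookup pBi (∈-lookup (ι j)))
      where
      i< = Fin.toℕ<n i
      ι : Fin (suc (toℕ i)) → Fin (length (v ∷ p))
      ι j = inject≤ j i<
      next : ∀ {j l} → Next j l → Adj (lookup (v ∷ p) (ι j)) (lookup (v ∷ p) (ι l))
      next {j} {l} (inj₁ l≡1+j) = Linked-lookup p∼ (ι j) (ι l)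
        (trans (Fin.toℕ-inject≤ l i<) (trans l≡1+j (cong suc (sym (Fin.toℕ-inject≤ j i<)))))
      -- The step from the last index back to 0 is the closing edge `vz`, traversed backwards.
      next {j} {l} (inj₂ (1+j≡n , l≡0)) = sym-Adj (subst₂ (λ s t → Adj (lookup (v ∷ p) s) (lookup (v ∷ p) t))
        (Fin.toℕ-injective {j = ι l} (sym (trans (Fin.toℕ-inject≤ l i<) l≡0)))
        (Fin.toℕ-injective (sym (trans (Fin.toℕ-inject≤ j i<) (suc-injective 1+j≡n)))) vz)
      copy : Copy (cycle (suc (toℕ i)) (≤-trans 3≤k k≤)) G
      copy = record
        { vertex    = lookup (v ∷ p) ∘ ι
        ; injective = λ {j} {l} eq → Fin.inject≤-injective i< i< j l (lookup-injective p! (ι j) (ι l) eq)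
        ; adjacent  = Sum.[ next , sym-Adj ∘ next ]
        }

    -- room bounds the number of times the path can still be extended at its head v.
    no-path : ∀ {xs} → Unique xs → All Bi xs → (∀ {v} → v ∈ xs → k ≤ 2 * degreeIn xs v) →
      ∀ room {v p} → length xs ≤ room + length (v ∷ p) →
      Unique (v ∷ p) → Linked Adj (v ∷ p) → ¬ All (_∈ xs) (v ∷ p)
    no-path {xs} xs! xsBi large room {v} {p} |xs|≤ p! p∼ p⊆xs
      with any? (λ u → Adj? v u ×-dec ¬? (u ∈? (v ∷ p))) xs
    ... | yes some with u , u∈xs , vu , u∉p ← find some = extend room |xs|≤
      where
      up! : Unique (u ∷ v ∷ p)
      up! = ¬Any⇒All¬ (v ∷ p) u∉p ∷ p!
      up⊆xs : All (_∈ xs) (u ∷ v ∷ p)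
      up⊆xs = u∈xs ∷ p⊆xs
      extend : ∀ room → length xs ≤ room + length (v ∷ p) → _
      -- With no room left, the extended path would consist of more distinct members of `xs` than
      -- `xs` has entries.
      extend zero       |xs|≤ = <-irrefl refl
        (≤-trans (length-≤-⊆ up! (All.lookup up⊆xs)) |xs|≤)
      extend (suc room) |xs|≤ = no-path xs! xsBi large room
        (≤-trans |xs|≤ (≤-reflexive (sym (+-suc room (length (v ∷ p)))))) up! (sym-Adj vu ∷ p∼) up⊆xs
    no-path {xs} xs! xsBi large room {v} {p} |xs|≤ p! p∼ p⊆xs | no none =
      -- The path cannot be extended at `v`, so all neighbours of `v` in `xs` lie on it, and by
      -- `no-closing-edge` they lie among its first k - 1 vertices `q`. The alternation of colours
      -- then gives 2 deg v ≤ k - 1.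
      <-irrefl refl (begin-strict
        k                              ≤⟨ large (All.lookup p⊆xs (here refl)) ⟩
        2 * degreeIn xs v              ≤⟨ *-monoʳ-≤ 2 (∑-≤-⊆ (adj v) xs! neighbour∈q) ⟩
        2 * degreeIn q v               ≤⟨ 2*degreeIn-path≤length col proper
                                           (Linked-take (suc k-2) p∼) (All.take⁺ (suc k-2) pBi) refl ⟩
        length q                       ≤⟨ ≤-trans (≤-reflexive (length-take (suc k-2) (v ∷ p))) (m⊓n≤m (suc k-2) _) ⟩
        suc k-2                        <⟨ ≤-reflexive (m+[n∸m]≡n (≤-trans (n≤1+n 2) 3≤k)) ⟩
        k                              ∎)
      where
      open ≤-Reasoning
      -- `q` is the initial segment of length at most k - 1, written with its head `v` split off
      -- because the alternation argument starts from a vertex of the colour of `v`.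
      k-2 = k ∸ 2
      q = v ∷ take k-2 p
      pBi : All Bi (v ∷ p)
      pBi = All.map (All.lookup xsBi) p⊆xs
      neighbour∈q : ∀ {u} → u ∈ xs → 0 < adj v u → u ∈ q
      neighbour∈q {u} u∈xs 0<adj with u ∈? (v ∷ p)
      ... | no u∉p = contradiction (lose u∈xs (𝟙>0⇒ (Adj? v u) 0<adj , u∉p)) none
      ... | yes u∈p with ∈-take-or-later (suc k-2) u∈p
      ...   | inj₁ u∈q = u∈q
      -- Indices start at 0, so index k - 1 already closes a cycle of length k.
      ...   | inj₂ (i , k-1≤i , refl) = contradiction (𝟙>0⇒ (Adj? v u) 0<adj)
              (no-closing-edge p! p∼ pBi i
                (≤-trans (≤-reflexive (sym (m+[n∸m]≡n (≤-trans (n≤1+n 2) 3≤k)))) (s≤s k-1≤i)))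

    -- If every degree were large, the path consisting of `v` alone, with room for the `length xs`
    -- other vertices, would contradict `no-path`.
    low-degree : ∀ {v xs} → Unique (v ∷ xs) → All Bi (v ∷ xs) →
                 ∃[ u ] u ∈ v ∷ xs × 2 * degreeIn (v ∷ xs) u < k
    low-degree {v} {xs} xs! xsBi with any? (λ u → 2 * degreeIn (v ∷ xs) u <? k) (v ∷ xs)
    ... | yes some = find some
    ... | no none  = contradiction (here refl ∷ [])
      (no-path xs! xsBi (λ u∈xs → ≮⇒≥ (All.lookup (¬Any⇒All¬ (v ∷ xs) none) u∈xs))
        (length xs) (≤-reflexive (sym (+-comm (length xs) 1))) ([] ∷ []) [-])

    -- Induction on the number of vertices: removing a vertex from `low-degree` loses at most k - 1
    -- adjacencies, and the last vertex carries none. The term k - 1 stands on the left in place of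
    -- a truncated subtraction on the right.
    adjacencies-bound : ∀ n {xs} → length xs ≡ suc n → Unique xs → All Bi xs →
                        adjacencies xs xs + (k ∸ 1) ≤ (k ∸ 1) * length xs
    adjacencies-bound zero {x ∷ []} _ _ _
      rewrite adj-≡col col proper {x} {x} refl = ≤-reflexive (sym (*-identityʳ (k ∸ 1)))
    adjacencies-bound (suc n) {x ∷ xs} |xs|≡ xs! xsBi
      with v , v∈xs , 2deg<k ← low-degree xs! xsBi
      with as , bs , eq ← ∈-∃++ v∈xs = begin
        adjacencies (x ∷ xs) (x ∷ xs) + K                 ≡⟨ cong (_+ K) (adjacencies-↭ perm) ⟩
        adjacencies (v ∷ ys) (v ∷ ys) + K                 ≤⟨ +-monoˡ-≤ K (adjacencies-∷ v ys) ⟩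
        2 * degreeIn (v ∷ ys) v + adjacencies ys ys + K   ≡⟨ +-assoc (2 * degreeIn (v ∷ ys) v) _ K ⟩
        2 * degreeIn (v ∷ ys) v + (adjacencies ys ys + K) ≤⟨ +-mono-≤ 2deg≤K (remaining
                                                               (Unique-resp-↭ perm xs!) (All-resp-↭ perm xsBi)) ⟩
        K + K * length ys                                 ≡⟨ *-suc K (length ys) ⟨
        K * suc (length ys)                               ≡⟨ cong (K *_) (↭-length perm) ⟨
        K * length (x ∷ xs)                               ∎
      where
      open ≤-Reasoning
      K = k ∸ 1
      ys = as ++ bs
      perm : x ∷ xs ↭ v ∷ ys
      perm = subst (_↭ v ∷ ys) (sym eq) (shift v as bs)
      2deg≤K : 2 * degreeIn (v ∷ ys) v ≤ K
      2deg≤K = ∸-monoˡ-≤ 1 (subst (λ d → 2 * d < k) (∑-↭ (adj v) perm) 2deg<k)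
      remaining : Unique (v ∷ ys) → All Bi (v ∷ ys) → adjacencies ys ys + K ≤ K * length ys
      remaining (_ ∷ ys!) (_ ∷ ysBi) =
        adjacencies-bound n (suc-injective (trans (sym (↭-length perm)) |xs|≡)) ys! ysBi

  -- Summation over all pairs of colour classes.

  module _ {c} (col : Vertex → Fin c) {k} (3≤k : 3 ≤ k) (cc : IsCycleColoring k G col)
           (onto : ∀ a → ∃[ v ] col v ≡ a) where

    private
      K = k ∸ 1
      V = allFin order

    class : Fin c → List Vertex
    class a = filter (λ v → col v Fin.≟ a) V

    class-unique : ∀ a → Unique (class a)
    class-unique a = filter⁺ (λ v → col v Fin.≟ a) (allFin⁺ order)

    -- The classes partition the vertices, so each ordered adjacent pair is counted for exactly one
    -- pair of colours.
    ∑∑-class : ∑[ a ∈ allFin c ] ∑[ b ∈ allFin c ] adjacencies (class a) (class b) ≡ 2 * size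
    ∑∑-class = begin
      ∑[ a ∈ allFin c ] ∑[ b ∈ allFin c ] adjacencies (class a) (class b)
        ≡⟨ ∑-cong (allFin c) (λ a → trans (∑-swap (allFin c) (class a) _)
             (∑-cong (class a) λ u → ∑-fibres col V (adj u))) ⟩
      ∑[ a ∈ allFin c ] adjacencies (class a) V
        ≡⟨ ∑-fibres col V (degreeIn V) ⟩
      adjacencies V V
        ≡⟨ ∑adj≡2*size ⟩
      2 * size ∎
      where open ≡-Reasoning

    ∑-class-length : ∑[ a ∈ allFin c ] length (class a) ≡ order
    ∑-class-length = begin
      ∑[ a ∈ allFin c ] length (class a)       ≡⟨ ∑-cong (allFin c) (λ a → length≡∑1 (class a)) ⟩
      ∑[ a ∈ allFin c ] ∑ (class a) (const 1)  ≡⟨ ∑-fibres col V (const 1) ⟩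
      ∑ V (const 1)                            ≡⟨ length≡∑1 V ⟨
      length V                                 ≡⟨ length-V ⟩
      order                                    ∎
      where open ≡-Reasoning

    adjacencies-class : ∀ a → adjacencies (class a) (class a) ≡ 0
    adjacencies-class a = none (class a) (class a) (all-filter _ V) (all-filter _ V)
      where
      none₁ : ∀ {u} ys → col u ≡ a → All (λ v → col v ≡ a) ys → degreeIn ys u ≡ 0
      none₁ []       _  []          = refl
      none₁ (y ∷ ys) pu (py ∷ pys) = cong₂ _+_ (adj-≡col col (proj₁ cc) (trans pu (sym py))) (none₁ ys pu pys)
      none : ∀ xs ys → All (λ v → col v ≡ a) xs → All (λ v → col v ≡ a) ys → adjacencies xs ys ≡ 0
      none []       ys _          _   = refl
      none (x ∷ xs) ys (px ∷ pxs) pys = cong₂ _+_ (none₁ ys px pys) (none xs ys pxs pys)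

    -- The terms with δ make the bound for a ≢ b trivially true on the diagonal as well.
    class-pair-bound : ∀ a b → let δ = 𝟙 (a Fin.≟ b); E = λ a b → adjacencies (class a) (class b) in
      E a b + E b a + K + δ * (K * (2 * length (class a))) ≤
      K * (length (class a) + length (class b)) + δ * K
    class-pair-bound a b with a Fin.≟ b
    ... | yes refl rewrite adjacencies-class a = ≤-reflexive
          (solve 2 (λ K l → K :+ con 1 :* (K :* (con 2 :* l)) := K :* (l :+ l) :+ con 1 :* K) refl K (length (class a)))
      where open ℕ.+-*-Solver
    ... | no a≢b = +-monoˡ-≤ 0 (begin
          E a b + E b a + K     ≤⟨ +-monoˡ-≤ K (≤-trans (+-mono-≤ (m≤n+m (E a b) (E a a)) (m≤m+n (E b a) (E b b)))
                                     (≤-reflexive (sym E-++))) ⟩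
          adjacencies ab ab + K ≤⟨ adjacencies-bound col 3≤k cc a b (length ab ∸ 1) (sym (m+[n∸m]≡n 0<|ab|)) ab! abBi ⟩
          K * length ab         ≡⟨ cong (K *_) (length-++ (class a)) ⟩
          K * (length (class a) + length (class b)) ∎)
      where
      open ≤-Reasoning
      E : Fin c → Fin c → ℕ
      E a b = adjacencies (class a) (class b)
      ab = class a ++ class b
      E-++ : adjacencies ab ab ≡ (E a a + E a b) + (E b a + E b b)
      E-++ = trans (adjacencies-++ (class a) (class b) ab)
        (cong₂ _+_ (adjacencies-++ʳ (class a) (class b) (class a)) (adjacencies-++ʳ (class a) (class b) (class b)))
      -- For an empty union the edge bound would read K ≤ 0, which is false; `onto` rules this case
      -- out.
      0<|ab| : 1 ≤ length ab
      0<|ab| with v , refl ← onto a = nonempty (∈-++⁺ˡ (∈-filter⁺ (λ u → col u Fin.≟ col v) (∈-allFin v) refl))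
        where
        nonempty : ∀ {xs : List Vertex} {v} → v ∈ xs → 1 ≤ length xs
        nonempty (here _)  = s≤s z≤n
        nonempty (there _) = s≤s z≤n
      ab! : Unique ab
      ab! = ++⁺ (class-unique a) (class-unique b) λ (v∈a , v∈b) →
        a≢b (trans (sym (All.lookup (all-filter _ V) v∈a)) (All.lookup (all-filter _ V) v∈b))
      abBi : All (λ v → col v ≡ a ⊎ col v ≡ b) ab
      abBi = All.++⁺ (All.map inj₁ (all-filter _ V)) (All.map inj₂ (all-filter _ V))

    -- The sum of `class-pair-bound` over all ordered pairs of colours. It is 2 (k - 1) times the
    -- inequality 2m / (k - 1) ≤ (c - 1) n - c (c - 1) / 2, with the negative terms moved to the
    -- other side.
    size-bound : 4 * size + K * (c * c + 2 * order) ≤ K * (2 * c * order + c)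
    size-bound = subst₂ _≤_ lhs rhs (∑-mono cs λ a → ∑-mono cs λ b → class-pair-bound a b)
      where
      open ≡-Reasoning
      cs = allFin c
      l : Fin c → ℕ
      l a = length (class a)
      |cs| : length cs ≡ c
      |cs| = length-tabulate (λ (a : Fin c) → a)
      E : Fin c → Fin c → ℕ
      E a b = adjacencies (class a) (class b)
      δ : Fin c → Fin c → ℕ
      δ a b = 𝟙 (a Fin.≟ b)
      ∑∑-+ : ∀ (f g : Fin c → Fin c → ℕ) → ∑[ a ∈ cs ] ∑[ b ∈ cs ] (f a b + g a b) ≡
             ∑[ a ∈ cs ] ∑[ b ∈ cs ] f a b + ∑[ a ∈ cs ] ∑[ b ∈ cs ] g a b
      ∑∑-+ f g = trans (∑-cong cs λ a → ∑-+ cs (f a) (g a)) (∑-+ cs (λ a → ∑ cs (f a)) (λ a → ∑ cs (g a)))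
      ∑∑-const : ∀ m → ∑[ a ∈ cs ] ∑[ b ∈ cs ] m ≡ c * (c * m)
      ∑∑-const m = trans (∑-cong cs λ _ → ∑-const cs m) (trans (∑-const cs _) (cong (λ x → x * (x * m)) |cs|))
      ∑∑-δ : ∀ f → ∑[ a ∈ cs ] ∑[ b ∈ cs ] (δ a b * f a) ≡ ∑ cs f
      ∑∑-δ f = ∑-cong cs λ a → ∑-Fin-δ a (const (f a))
      lhs : ∑[ a ∈ cs ] ∑[ b ∈ cs ] (E a b + E b a + K + δ a b * (K * (2 * l a))) ≡
            4 * size + K * (c * c + 2 * order)
      lhs = begin
        ∑[ a ∈ cs ] ∑[ b ∈ cs ] (E a b + E b a + K + δ a b * (K * (2 * l a)))
          ≡⟨ trans (∑∑-+ (λ a b → E a b + E b a + K) _) (cong₂ _+_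
               (trans (∑∑-+ (λ a b → E a b + E b a) _) (cong₂ _+_ (∑∑-+ E _) (∑∑-const K)))
               (trans (∑∑-δ _) (trans (∑-* K cs _) (cong (K *_) (trans (∑-* 2 cs l) (cong (2 *_) ∑-class-length)))))) ⟩
        ∑[ a ∈ cs ] ∑[ b ∈ cs ] E a b + ∑[ a ∈ cs ] ∑[ b ∈ cs ] E b a + c * (c * K) + K * (2 * order)
          ≡⟨ cong (λ m → m + c * (c * K) + K * (2 * order))
               (cong₂ _+_ ∑∑-class (trans (∑-swap cs cs (λ a b → E b a)) ∑∑-class)) ⟩
        2 * size + 2 * size + c * (c * K) + K * (2 * order)
          ≡⟨ solve 4 (λ m c K n → con 2 :* m :+ con 2 :* m :+ c :* (c :* K) :+ K :* (con 2 :* n) :=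
                                  con 4 :* m :+ K :* (c :* c :+ con 2 :* n)) refl size c K order ⟩
        4 * size + K * (c * c + 2 * order) ∎
        where open ℕ.+-*-Solver
      rhs : ∑[ a ∈ cs ] ∑[ b ∈ cs ] (K * (l a + l b) + δ a b * K) ≡ K * (2 * c * order + c)
      rhs = begin
        ∑[ a ∈ cs ] ∑[ b ∈ cs ] (K * (l a + l b) + δ a b * K)
          ≡⟨ trans (∑∑-+ (λ a b → K * (l a + l b)) _) (cong₂ _+_ ∑∑-l
               (trans (∑∑-δ (const K)) (trans (∑-const cs K) (cong (_* K) |cs|)))) ⟩
        K * (c * order + c * order) + c * K
          ≡⟨ solve 3 (λ c K n → K :* (c :* n :+ c :* n) :+ c :* K := K :* (con 2 :* c :* n :+ c)) refl c K order ⟩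
        K * (2 * c * order + c) ∎
        where
        open ℕ.+-*-Solver
        ∑∑-l : ∑[ a ∈ cs ] ∑[ b ∈ cs ] (K * (l a + l b)) ≡ K * (c * order + c * order)
        ∑∑-l = begin
          ∑[ a ∈ cs ] ∑[ b ∈ cs ] (K * (l a + l b))
            ≡⟨ ∑-cong cs (λ a → trans (∑-* K cs _) (cong (K *_) (∑-+ cs (const (l a)) l))) ⟩
          ∑[ a ∈ cs ] (K * (∑ cs (const (l a)) + ∑ cs l))
            ≡⟨ trans (∑-* K cs _) (cong (K *_) (∑-+ cs (λ a → ∑ cs (const (l a))) (const (∑ cs l)))) ⟩
          K * (∑[ a ∈ cs ] ∑ cs (const (l a)) + ∑[ a ∈ cs ] ∑ cs l)
            ≡⟨ cong (K *_) (cong₂ _+_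
                 (trans (∑-cong cs λ a → trans (∑-const cs (l a)) (cong (_* l a) |cs|))
                        (trans (∑-* c cs l) (cong (c *_) ∑-class-length)))
                 (trans (∑-const cs _) (cong₂ _*_ |cs| ∑-class-length))) ⟩
          K * (c * order + c * order) ∎

-- Colourings with the least number of colours.

minimal⇒onto : ∀ {k G c} → IsCycleChromaticNumber k G c →
               ((col , _) : CycleColorable k G c) → ∀ a → ∃[ v ] col v ≡ a
minimal⇒onto {k} {G} {suc c} (_ , least) (col , proper , acyclic) a with Fin.any? (λ v → col v Fin.≟ a)
... | yes used  = used
... | no unused = contradiction (least c (col′ , proper′ , acyclic′)) 1+n≰n
  where
  a≢col : ∀ v → a ≢ col v
  a≢col v a≡ = unused (v , sym a≡)
  col′ : Graph.Vertex G → Fin c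
  col′ v = punchOut (a≢col v)
  proper′ : Proper G col′
  proper′ {u} {v} uv eq = proper uv (Fin.punchOut-injective (a≢col u) (a≢col v) eq)
  punchIn-col′ : ∀ {v b} → col′ v ≡ b → col v ≡ punchIn a b
  punchIn-col′ {v} eq = trans (sym (Fin.punchIn-punchOut (a≢col v))) (cong (punchIn a) eq)
  acyclic′ : ∀ i (3≤i : 3 ≤ i) → k ≤ i → (S : Copy (cycle i 3≤i) G) → ¬ Bicolored col′ S
  acyclic′ i 3≤i k≤i S (b₁ , b₂ , two) =
    acyclic i 3≤i k≤i S (punchIn a b₁ , punchIn a b₂ , Sum.map punchIn-col′ punchIn-col′ ∘ two)

-- Rational arithmetic

-- Identities for `fromℕ` are proved on unnormalised fractions, where they reduce to integer
-- identities.
toℚᵘ-fromℕ : ∀ n → toℚᵘ (fromℕ n) ℚᵘ.≃ mkℚᵘ (ℤ.+ n) 0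
toℚᵘ-fromℕ n = ℚ.toℚᵘ-fromℚᵘ (mkℚᵘ (ℤ.+ n) 0)

fromℕ-+ : ∀ m n → fromℕ (m + n) ≡ fromℕ m ℚ.+ fromℕ n
fromℕ-+ m n = ℚ.toℚᵘ-injective (begin-equality
  toℚᵘ (fromℕ (m + n))                         ≃⟨ toℚᵘ-fromℕ (m + n) ⟩
  mkℚᵘ (ℤ.+ (m + n)) 0                         ≃⟨ *≡* (cong (ℤ._* ℤ.+ 1) (trans (ℤ.pos-+ m n)
                                                    (sym (cong₂ ℤ._+_ (ℤ.*-identityʳ (ℤ.+ m)) (ℤ.*-identityʳ (ℤ.+ n)))))) ⟩
  mkℚᵘ (ℤ.+ m) 0 ℚᵘ.+ mkℚᵘ (ℤ.+ n) 0           ≃⟨ ℚᵘ.+-cong (toℚᵘ-fromℕ m) (toℚᵘ-fromℕ n) ⟨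
  toℚᵘ (fromℕ m) ℚᵘ.+ toℚᵘ (fromℕ n)           ≃⟨ ℚ.toℚᵘ-homo-+ (fromℕ m) (fromℕ n) ⟨
  toℚᵘ (fromℕ m ℚ.+ fromℕ n)                   ∎)
  where open ℚᵘ.≤-Reasoning

fromℕ-* : ∀ m n → fromℕ (m * n) ≡ fromℕ m ℚ.* fromℕ n
fromℕ-* m n = ℚ.toℚᵘ-injective (begin-equality
  toℚᵘ (fromℕ (m * n))                         ≃⟨ toℚᵘ-fromℕ (m * n) ⟩
  mkℚᵘ (ℤ.+ (m * n)) 0                         ≃⟨ *≡* (cong (ℤ._* ℤ.+ 1) (ℤ.pos-* m n)) ⟩
  mkℚᵘ (ℤ.+ m) 0 ℚᵘ.* mkℚᵘ (ℤ.+ n) 0           ≃⟨ ℚᵘ.*-cong (toℚᵘ-fromℕ m) (toℚᵘ-fromℕ n) ⟨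
  toℚᵘ (fromℕ m) ℚᵘ.* toℚᵘ (fromℕ n)           ≃⟨ ℚ.toℚᵘ-homo-* (fromℕ m) (fromℕ n) ⟨
  toℚᵘ (fromℕ m ℚ.* fromℕ n)                   ∎)
  where open ℚᵘ.≤-Reasoning

fromℕ-mono-≤ : ∀ m n → m ≤ n → fromℕ m ℚ.≤ fromℕ n
fromℕ-mono-≤ m n m≤n = ℚ.toℚᵘ-cancel-≤ (begin
  toℚᵘ (fromℕ m)   ≃⟨ toℚᵘ-fromℕ m ⟩
  mkℚᵘ (ℤ.+ m) 0   ≤⟨ *≤* (ℤ.*-monoʳ-≤-nonNeg (ℤ.+ 1) (ℤ.+≤+ m≤n)) ⟩
  mkℚᵘ (ℤ.+ n) 0   ≃⟨ toℚᵘ-fromℕ n ⟨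
  toℚᵘ (fromℕ n)   ∎)
  where open ℚᵘ.≤-Reasoning

/-*-cancel : ∀ p d .{{_ : NonZero d}} → (ℤ.+ p ℚ./ d) ℚ.* fromℕ d ≡ fromℕ p
/-*-cancel p d@(suc d-1) = ℚ.toℚᵘ-injective (begin-equality
  toℚᵘ ((ℤ.+ p ℚ./ d) ℚ.* fromℕ d)          ≃⟨ ℚ.toℚᵘ-homo-* (ℤ.+ p ℚ./ d) (fromℕ d) ⟩
  toℚᵘ (ℤ.+ p ℚ./ d) ℚᵘ.* toℚᵘ (fromℕ d)    ≃⟨ ℚᵘ.*-cong (ℚ.toℚᵘ-fromℚᵘ (mkℚᵘ (ℤ.+ p) d-1)) (toℚᵘ-fromℕ d) ⟩
  mkℚᵘ (ℤ.+ p) d-1 ℚᵘ.* mkℚᵘ (ℤ.+ d) 0      ≃⟨ *≡* (trans (ℤ.*-identityʳ (ℤ.+ p ℤ.* ℤ.+ d))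
                                                 (cong (λ e → ℤ.+ p ℤ.* ℤ.+ suc e) (sym (*-identityʳ d-1)))) ⟩
  mkℚᵘ (ℤ.+ p) 0                            ≃⟨ toℚᵘ-fromℕ p ⟨
  toℚᵘ (fromℕ p)                            ∎)
  where open ℚᵘ.≤-Reasoning

-- Carries an inequality between natural numbers, with denominators cleared, over to the fraction
-- 16m / (k - 1) in `Δ`.
/-+-bound : ∀ p d s t .{{_ : NonZero d}} → p + d * s ≤ d * t → (ℤ.+ p ℚ./ d) ℚ.+ fromℕ s ℚ.≤ fromℕ t
/-+-bound p d s t bound = ℚ.*-cancelʳ-≤-pos (fromℕ d) {{d>0}} (begin
  ((ℤ.+ p ℚ./ d) ℚ.+ fromℕ s) ℚ.* fromℕ d            ≡⟨ ℚ.*-distribʳ-+ (fromℕ d) (ℤ.+ p ℚ./ d) (fromℕ s) ⟩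
  (ℤ.+ p ℚ./ d) ℚ.* fromℕ d ℚ.+ fromℕ s ℚ.* fromℕ d  ≡⟨ cong₂ ℚ._+_ (/-*-cancel p d)
                                                           (trans (ℚ.*-comm (fromℕ s) (fromℕ d)) (sym (fromℕ-* d s))) ⟩
  fromℕ p ℚ.+ fromℕ (d * s)                          ≡⟨ fromℕ-+ p (d * s) ⟨
  fromℕ (p + d * s)                                  ≤⟨ fromℕ-mono-≤ (p + d * s) (d * t) bound ⟩
  fromℕ (d * t)                                      ≡⟨ fromℕ-* d t ⟩
  fromℕ d ℚ.* fromℕ t                                ≡⟨ ℚ.*-comm (fromℕ d) (fromℕ t) ⟩
  fromℕ t ℚ.* fromℕ d                                ∎)
  where
  open ℚ.≤-Reasoning
  d>0 : ℚ.Positive (fromℕ d)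
  d>0 = ℚ.normalize-pos d 1

0≤fromℕ : ∀ n → 0ℚ ℚ.≤ fromℕ n
0≤fromℕ n = fromℕ-mono-≤ 0 n z≤n

p≤q⇒0≤q-p : ∀ {p q} → p ℚ.≤ q → 0ℚ ℚ.≤ q ℚ.- p
p≤q⇒0≤q-p {p} {q} p≤q = subst (ℚ._≤ q ℚ.- p) (ℚ.+-inverseʳ p) (ℚ.+-monoˡ-≤ (ℚ.- p) p≤q)

p≤p+q : ∀ p {q} → 0ℚ ℚ.≤ q → p ℚ.≤ p ℚ.+ q
p≤p+q p {q} 0≤q = subst (ℚ._≤ p ℚ.+ q) (ℚ.+-identityʳ p) (ℚ.+-monoʳ-≤ p 0≤q)

-- The polynomial inequalities below exhibit the difference of the two sides as an expression `d`
-- known to be nonnegative; what remains is a ring identity.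
nonneg-slack : ∀ {p d q} → 0ℚ ℚ.≤ d → p ℚ.+ d ≡ q → p ℚ.≤ q
nonneg-slack {p} 0≤d p+d≡q = subst (p ℚ.≤_) p+d≡q (p≤p+q p 0≤d)

+-nonneg : ∀ {p q} → 0ℚ ℚ.≤ p → 0ℚ ℚ.≤ q → 0ℚ ℚ.≤ p ℚ.+ q
+-nonneg {p} 0≤p 0≤q = ℚ.≤-trans 0≤p (p≤p+q p 0≤q)

-- `Δ` with the fraction 16m / (k - 1) replaced by a variable `x`, which makes it a polynomial.
Δ-expr : ℚ → ℚ → ℚ
Δ-expr n x = fromℕ 4 ℚ.* n ℚ.* (n ℚ.- 1ℚ) ℚ.- x ℚ.+ 1ℚ

-- The second hypothesis bounds `Δ-expr n x` below by n² - n + 1, and half of the first, n ≤ n² / 2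
-- + 1, turns this into n² / 2.
Δ-expr-lower : ∀ n x → fromℕ 2 ℚ.* n ℚ.≤ n ℚ.* n ℚ.+ fromℕ 2 →
               x ℚ.+ fromℕ 3 ℚ.* n ℚ.≤ fromℕ 3 ℚ.* (n ℚ.* n) → ½ ℚ.* (n ℚ.* n) ℚ.≤ Δ-expr n x
Δ-expr-lower n x h₁ h₂ = nonneg-slack
  (+-nonneg (p≤q⇒0≤q-p (ℚ.*-monoˡ-≤-nonNeg ½ h₁)) (p≤q⇒0≤q-p h₂))
  (solve 2 (λ n x →
    con ½ :* (n :* n) :+ ((con ½ :* (n :* n :+ con (fromℕ 2)) :- con ½ :* (con (fromℕ 2) :* n))
      :+ (con (fromℕ 3) :* (n :* n) :- (x :+ con (fromℕ 3) :* n))) :=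
    con (fromℕ 4) :* n :* (n :- con 1ℚ) :- x :+ con 1ℚ) refl n x)
  where open ℚ.+-*-Solver

-- The leading term 4n² needs one further n² to absorb the summand 1, hence the constant 5.
Δ-expr-upper : ∀ n x → 1ℚ ℚ.≤ n ℚ.* n → 0ℚ ℚ.≤ fromℕ 4 ℚ.* n → 0ℚ ℚ.≤ x →
               Δ-expr n x ℚ.≤ fromℕ 5 ℚ.* (n ℚ.* n)
Δ-expr-upper n x 1≤n² 0≤4n 0≤x = nonneg-slack
  (+-nonneg (p≤q⇒0≤q-p 1≤n²) (+-nonneg 0≤4n 0≤x))
  (solve 2 (λ n x →
    con (fromℕ 4) :* n :* (n :- con 1ℚ) :- x :+ con 1ℚ
      :+ ((n :* n :- con 1ℚ) :+ (con (fromℕ 4) :* n :+ x)) :=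
    con (fromℕ 5) :* (n :* n)) refl n x)
  where open ℚ.+-*-Solver

-- The case k = 3: with `t` for the binomial coefficient, 4n (n - 1) is 8t, and `x` is 8m.
Δ-expr-nonedges : ∀ n x t m → n ℚ.* n ≡ fromℕ 2 ℚ.* t ℚ.+ n → x ℚ.* fromℕ 2 ≡ fromℕ 16 ℚ.* m →
                  Δ-expr n x ≡ fromℕ 8 ℚ.* (t ℚ.- m) ℚ.+ 1ℚ
Δ-expr-nonedges n x t m n²≡ 2x≡ = begin
  fromℕ 4 ℚ.* n ℚ.* (n ℚ.- 1ℚ) ℚ.- x ℚ.+ 1ℚ
    ≡⟨ solve 2 (λ n x →
         con (fromℕ 4) :* n :* (n :- con 1ℚ) :- x :+ con 1ℚ :=
         con (fromℕ 4) :* (n :* n :- n) :- con ½ :* (x :* con (fromℕ 2)) :+ con 1ℚ) refl n x ⟩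
  fromℕ 4 ℚ.* (n ℚ.* n ℚ.- n) ℚ.- ½ ℚ.* (x ℚ.* fromℕ 2) ℚ.+ 1ℚ
    ≡⟨ cong₂ (λ y z → fromℕ 4 ℚ.* (y ℚ.- n) ℚ.- ½ ℚ.* z ℚ.+ 1ℚ) n²≡ 2x≡ ⟩
  fromℕ 4 ℚ.* ((fromℕ 2 ℚ.* t ℚ.+ n) ℚ.- n) ℚ.- ½ ℚ.* (fromℕ 16 ℚ.* m) ℚ.+ 1ℚ
    ≡⟨ solve 3 (λ n t m →
         con (fromℕ 4) :* ((con (fromℕ 2) :* t :+ n) :- n) :- con ½ :* (con (fromℕ 16) :* m) :+ con 1ℚ :=
         con (fromℕ 8) :* (t :- m) :+ con 1ℚ) refl n t m ⟩
  fromℕ 8 ℚ.* (t ℚ.- m) ℚ.+ 1ℚ ∎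
  where
  open ≡-Reasoning
  open ℚ.+-*-Solver

8f+1≤9f : ∀ f → 1ℚ ℚ.≤ f → fromℕ 8 ℚ.* f ℚ.+ 1ℚ ℚ.≤ fromℕ 9 ℚ.* f
8f+1≤9f f 1≤f = nonneg-slack (p≤q⇒0≤q-p 1≤f)
  (solve 1 (λ f → con (fromℕ 8) :* f :+ con 1ℚ :+ (f :- con 1ℚ) := con (fromℕ 9) :* f) refl f)
  where open ℚ.+-*-Solver

-- The hypothesis says that the quadratic γ² − (2n + 1) γ + 2n + x / 4, whose discriminant is
-- Δ-expr n x, is nonpositive at γ.
square≤Δ-expr : ∀ n γ x p → p ≡ fromℕ 2 ℚ.* n ℚ.+ 1ℚ →
  x ℚ.+ fromℕ 4 ℚ.* (γ ℚ.* γ ℚ.+ fromℕ 2 ℚ.* n) ℚ.≤ fromℕ 4 ℚ.* (fromℕ 2 ℚ.* γ ℚ.* n ℚ.+ γ) →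
  (p ℚ.- fromℕ 2 ℚ.* γ) ℚ.* (p ℚ.- fromℕ 2 ℚ.* γ) ℚ.≤ Δ-expr n x
square≤Δ-expr n γ x _ refl h = nonneg-slack (p≤q⇒0≤q-p h)
  (solve 3 (λ n γ x →
    let s = con (fromℕ 2) :* n :+ con 1ℚ :- con (fromℕ 2) :* γ in
    s :* s :+ (con (fromℕ 4) :* (con (fromℕ 2) :* γ :* n :+ γ) :- (x :+ con (fromℕ 4) :* (γ :* γ :+ con (fromℕ 2) :* n))) :=
    con (fromℕ 4) :* n :* (n :- con 1ℚ) :- x :+ con 1ℚ) refl n γ x)
  where open ℚ.+-*-Solver

2*nC2+n≡n*n : ∀ n → 2 * (n C 2) + n ≡ n * n
2*nC2+n≡n*n zero    = refl
2*nC2+n≡n*n (suc n) = begin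
  2 * (suc n C 2) + suc n      ≡⟨ cong (λ m → 2 * m + suc n) (nCk+nC[k+1]≡[n+1]C[k+1] n 1) ⟨
  2 * (n C 1 + n C 2) + suc n  ≡⟨ cong (λ m → 2 * (m + n C 2) + suc n) (nC1≡n n) ⟩
  2 * (n + n C 2) + suc n      ≡⟨ solve 2 (λ n t → con 2 :* (n :+ t) :+ (con 1 :+ n) :=
                                    (con 2 :* t :+ n) :+ (con 2 :* n :+ con 1)) refl n (n C 2) ⟩
  (2 * (n C 2) + n) + (2 * n + 1) ≡⟨ cong (_+ (2 * n + 1)) (2*nC2+n≡n*n n) ⟩
  n * n + (2 * n + 1)          ≡⟨ solve 1 (λ n → n :* n :+ (con 2 :* n :+ con 1) :=
                                    (con 1 :+ n) :* (con 1 :+ n)) refl n ⟩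
  suc n * suc n                ∎
  where
  open ≡-Reasoning
  open ℕ.+-*-Solver

2*n≤n*n+2 : ∀ n → 2 * n ≤ n * n + 2
2*n≤n*n+2 zero          = z≤n
2*n≤n*n+2 (suc zero)    = s≤s (s≤s z≤n)
2*n≤n*n+2 n@(suc (suc m)) = ≤-trans (*-monoˡ-≤ n {2} {n} (s≤s (s≤s z≤n))) (m≤m+n (n * n) 2)

*-square-mono-< : ∀ {p q} → 0ℚ ℚ.≤ p → p ℚ.< q → p ℚ.* p ℚ.< q ℚ.* q
*-square-mono-< {p} {q} 0≤p p<q = ℚ.≤-<-trans
  (ℚ.*-monoˡ-≤-nonNeg p {{ℚ.nonNegative 0≤p}} (ℚ.<⇒≤ p<q))
  (ℚ.*-monoˡ-<-pos q {{ℚ.positive (ℚ.≤-<-trans 0≤p p<q)}} p<q)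

-- The order of magnitude of `Δ`.

Δ=Θorder² : _=Θ_ {I = (∃[ k ] 4 ≤ k) × Graph}
  (λ ((k , 4≤k) , G) → Δ k (≤-trans (n≤1+n 3) 4≤k) G) (λ (_ , G) → order² G)
-- The constants are uniform in `k`. The threshold 1 excludes just the graph without vertices, where
-- `Δ` is 1 but `order²` is 0.
Δ=Θorder² = ½ , fromℕ 5 , 1ℚ , ℚ.positive⁻¹ ½ , ℚ.positive⁻¹ (fromℕ 5) ,
            λ ((k , 4≤k) , G) 1≤n² → bounds k 4≤k G 1≤n²
  where
  bounds : ∀ k (4≤k : 4 ≤ k) G → 1ℚ ℚ.≤ order² G →
           ½ ℚ.* order² G ℚ.≤ Δ k (≤-trans (n≤1+n 3) 4≤k) G ×
           Δ k (≤-trans (n≤1+n 3) 4≤k) G ℚ.≤ fromℕ 5 ℚ.* order² G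
  bounds (suc K@(suc _)) 4≤k@(s≤s 3≤K) G 1≤n² =
    Δ-expr-lower n x 2n≤n²+2 x-bound , Δ-expr-upper n x 1≤n² 0≤4n 0≤x
    where
    N = Graph.order G
    M = Graph.size G
    n = fromℕ N
    x = ℤ.+ (16 * M) ℚ./ K
    bound : 16 * M + K * (3 * N) ≤ K * (3 * (N * N))
    -- Since k ≥ 4 gives K ≥ 3, one has 16 ≤ 18 ≤ 6K. So the fraction is at most 6m, and 2m + n ≤ n²
    -- bounds this by 3 (n² - n).
    bound = ≤-trans (+-monoˡ-≤ (K * (3 * N)) (*-monoˡ-≤ M (≤-trans (m≤m+n 16 2) (*-monoʳ-≤ 6 3≤K))))
      (subst₂ _≤_
        (solve 3 (λ K M N → con 3 :* K :* (con 2 :* M :+ N) := con 6 :* K :* M :+ K :* (con 3 :* N)) refl K M N)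
        (solve 2 (λ K N² → con 3 :* K :* N² := K :* (con 3 :* N²)) refl K (N * N))
        (*-monoʳ-≤ (3 * K) (2*size+order≤order² G)))
      where open ℕ.+-*-Solver
    x-bound : x ℚ.+ fromℕ 3 ℚ.* n ℚ.≤ fromℕ 3 ℚ.* (n ℚ.* n)
    x-bound = subst₂ ℚ._≤_ (cong (x ℚ.+_) (fromℕ-* 3 N))
      (trans (fromℕ-* 3 (N * N)) (cong (fromℕ 3 ℚ.*_) (fromℕ-* N N)))
      (/-+-bound (16 * M) K (3 * N) (3 * (N * N)) bound)
    2n≤n²+2 : fromℕ 2 ℚ.* n ℚ.≤ n ℚ.* n ℚ.+ fromℕ 2
    2n≤n²+2 = subst₂ ℚ._≤_ (fromℕ-* 2 N)
      (trans (fromℕ-+ (N * N) 2) (cong (ℚ._+ fromℕ 2) (fromℕ-* N N)))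
      (fromℕ-mono-≤ (2 * N) (N * N + 2) (2*n≤n*n+2 N))
    0≤x : 0ℚ ℚ.≤ x
    0≤x = ℚ.nonNegative⁻¹ x {{ℚ.normalize-nonNeg (16 * M) K}}
    0≤4n : 0ℚ ℚ.≤ fromℕ 4 ℚ.* n
    0≤4n = subst (0ℚ ℚ.≤_) (fromℕ-* 4 N) (0≤fromℕ (4 * N))

Δ₃≡8*nonedges+1 : ∀ G → Δ 3 ≤-refl G ≡ fromℕ 8 ℚ.* nonedges G ℚ.+ 1ℚ
Δ₃≡8*nonedges+1 G = Δ-expr-nonedges n x t m n*n≡ x*2≡
  where
  open ≡-Reasoning
  N = Graph.order G
  M = Graph.size G
  n = fromℕ N
  m = fromℕ M
  t = fromℕ (N C 2)
  x = ℤ.+ (16 * M) ℚ./ 2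
  n*n≡ : n ℚ.* n ≡ fromℕ 2 ℚ.* t ℚ.+ n
  n*n≡ = begin
    n ℚ.* n                     ≡⟨ fromℕ-* N N ⟨
    fromℕ (N * N)               ≡⟨ cong fromℕ (2*nC2+n≡n*n N) ⟨
    fromℕ (2 * (N C 2) + N)     ≡⟨ fromℕ-+ (2 * (N C 2)) N ⟩
    fromℕ (2 * (N C 2)) ℚ.+ n   ≡⟨ cong (ℚ._+ n) (fromℕ-* 2 (N C 2)) ⟩
    fromℕ 2 ℚ.* t ℚ.+ n         ∎
  x*2≡ : x ℚ.* fromℕ 2 ≡ fromℕ 16 ℚ.* m
  x*2≡ = trans (/-*-cancel (16 * M) 2) (fromℕ-* 16 M)

Δ₃=Θnonedges : _=Θ_ {I = Graph} (λ G → Δ 3 ≤-refl G) nonedges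
-- As `Δ` is 8f + 1 with f the number of nonedges, 8 serves below, and 9 serves above once f ≥ 1.
Δ₃=Θnonedges = fromℕ 8 , fromℕ 9 , 1ℚ , ℚ.positive⁻¹ (fromℕ 8) , ℚ.positive⁻¹ (fromℕ 9) , λ G 1≤f →
  subst (λ d → fromℕ 8 ℚ.* nonedges G ℚ.≤ d × d ℚ.≤ fromℕ 9 ℚ.* nonedges G) (sym (Δ₃≡8*nonedges+1 G))
    ( p≤p+q _ (ℚ.nonNegative⁻¹ 1ℚ)
    , 8f+1≤9f (nonedges G) 1≤f )

-- The quadratic inequality and the bound on the chromatic number.

[2n+1-2c]²≤Δ : ∀ {k} (3≤k : 3 ≤ k) G {c} → IsCycleChromaticNumber k G c →
  let s = fromℕ (2 * Graph.order G + 1) ℚ.- fromℕ 2 ℚ.* fromℕ c in s ℚ.* s ℚ.≤ Δ k 3≤k G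
[2n+1-2c]²≤Δ {suc K@(suc _)} 3≤k@(s≤s (s≤s _)) G {c} χ@((col , cc) , _) =
  square≤Δ-expr n γ x (fromℕ (2 * N + 1))
    (trans (fromℕ-+ (2 * N) 1) (cong (ℚ._+ 1ℚ) (fromℕ-* 2 N))) x-bound
  where
  N = Graph.order G
  M = Graph.size G
  n = fromℕ N
  γ = fromℕ c
  x = ℤ.+ (16 * M) ℚ./ K
  bound : 16 * M + K * (4 * (c * c + 2 * N)) ≤ K * (4 * (2 * c * N + c))
  -- The factor 4 produces the numerator 16m that occurs in `Δ`.
  bound = subst₂ _≤_
    (solve 3 (λ M K t → con 4 :* (con 4 :* M :+ K :* t) := con 16 :* M :+ K :* (con 4 :* t)) refl M K (c * c + 2 * N))
    (solve 2 (λ K t → con 4 :* (K :* t) := K :* (con 4 :* t)) refl K (2 * c * N + c))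
    (*-monoʳ-≤ 4 (size-bound G col 3≤k cc (minimal⇒onto χ (col , cc))))
    where open ℕ.+-*-Solver
  x-bound : x ℚ.+ fromℕ 4 ℚ.* (γ ℚ.* γ ℚ.+ fromℕ 2 ℚ.* n) ℚ.≤ fromℕ 4 ℚ.* (fromℕ 2 ℚ.* γ ℚ.* n ℚ.+ γ)
  x-bound = subst₂ ℚ._≤_
    (cong (x ℚ.+_) (trans (fromℕ-* 4 (c * c + 2 * N)) (cong (fromℕ 4 ℚ.*_)
      (trans (fromℕ-+ (c * c) (2 * N)) (cong₂ ℚ._+_ (fromℕ-* c c) (fromℕ-* 2 N))))))
    (trans (fromℕ-* 4 (2 * c * N + c)) (cong (fromℕ 4 ℚ.*_)
      (trans (fromℕ-+ (2 * c * N) c) (cong (ℚ._+ γ)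
        (trans (fromℕ-* (2 * c) N) (cong (ℚ._* n) (fromℕ-* 2 c)))))))
    (/-+-bound (16 * M) K (4 * (c * c + 2 * N)) (4 * (2 * c * N + c)) bound)

-- Write p = 2n + 1. By the definition of the cuts, a rational q below the right-hand side comes
-- with some r such that 0 ≤ r < p - 2q and Δ ≤ r². If a ≤ q, then r < p - 2a, so r² < (p - 2a)² ≤ Δ
-- ≤ r², a contradiction; hence q < a.
chromatic-lower-bound : ∀ k (3≤k : 3 ≤ k) G a → IsCycleChromaticNumber k G a →
  fromℚ (fromℕ a) ≥ᴿ ½ *ᴿ (fromℕ (2 * Graph.order G + 1) -ᴿ (√ (Δ k 3≤k G)))
chromatic-lower-bound k 3≤k G a χ q (r , r<p-2q , 0≤r , Δ≤r²) = ℚ.≰⇒> λ a≤q →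
  let r<s = ℚ.<-≤-trans r<p-2q (ℚ.+-monoʳ-≤ (fromℕ (2 * Graph.order G + 1))
              (ℚ.neg-antimono-≤ (ℚ.*-monoˡ-≤-nonNeg (fromℕ 2) a≤q)))
  in ℚ.<-irrefl refl (ℚ.<-≤-trans (*-square-mono-< 0≤r r<s) (ℚ.≤-trans ([2n+1-2c]²≤Δ 3≤k G χ) Δ≤r²))

theorem3 :
  (_=Θ_ {I = (∃[ k ] 4 ≤ k) × Graph}
     (λ ((k , 4≤k) , G) → Δ k (≤-trans (n≤1+n 3) 4≤k) G)
     (λ (_ , G) → order² G)) ×
  (_=Θ_ {I = Graph} (λ G → Δ 3 ≤-refl G) nonedges) ×
  (∀ (k : ℕ) (3≤k : 3 ≤ k) (G : Graph) (a : ℕ) →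
     IsCycleChromaticNumber k G a →
     fromℚ (fromℕ a) ≥ᴿ ½ *ᴿ (fromℕ (2 * Graph.order G + 1) -ᴿ (√ (Δ k 3≤k G))))
theorem3 = Δ=Θorder² , Δ₃=Θnonedges , chromatic-lower-bound
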